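{- For every integer $n \geq 59$, there is a regular $K_5$-saturated graph with $n$ vertices.
   Context: All graphs are finite and simple. A graph $G$ is $K_5$-saturated if $G$ contains no subgraph isomorphic to $K_5$ (the complete graph on 5 vertices), but adding any edge between two nonadjacent vertices creates a $K_5$. A graph is regular if all its vertices have the same degree. -}

module Defs where

open import Data.Nat using (ℕ)
open import Data.Bool using (Bool; true; false; _∨_; _∧_)
open import Data.Fin using (Fin; _≟_)
open import Data.List using (List; length; filter; allFin)
import Data.Bool
open import Data.Fin.Properties using ()
open import Data.Product using (Σ; ∃; ∃-syntax; _×_; _,_)
open import Relation.Nullary using (¬_; does)
open import Relation.Binary.PropositionalEquality using (_≡_; _≢_)
open import Function.Definitions using (Injective)

record Graph (n : ℕ) : Set where
  field
    adj   : Fin n → Fin n → Bool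
    sym   : ∀ u v → adj u v ≡ adj v u
    irrefl : ∀ v → adj v v ≡ false
open Graph public

addEdge : ∀ {n} → (Fin n → Fin n → Bool) → Fin n → Fin n → (Fin n → Fin n → Bool)
addEdge a u v x y =
  a x y ∨ ((does (x ≟ u) ∧ does (y ≟ v)) ∨ (does (x ≟ v) ∧ does (y ≟ u)))

HasK5 : ∀ {n} → (Fin n → Fin n → Bool) → Set
HasK5 {n} a = Σ (Fin 5 → Fin n) λ f →
  Injective _≡_ _≡_ f × (∀ i j → i ≢ j → a (f i) (f j) ≡ true)

K5Saturated : ∀ {n} → Graph n → Set
K5Saturated G =
  ¬ HasK5 (adj G) ×
  (∀ u v → u ≢ v → adj G u v ≡ false → HasK5 (addEdge (adj G) u v))

degree : ∀ {n} → Graph n → Fin n → ℕ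
degree G v = length (filter (λ w → adj G v w Data.Bool.≟ true) (allFin _))

Regular : ∀ {n} → Graph n → Set
Regular {n} G = ∃[ d ] (∀ v → degree G v ≡ d)

{-# OPTIONS --safe #-}
-- If A and B are K₃-saturated graphs with an edge, then their join is K₅-saturated, and if A
-- and B are regular it is regular as soon as n - degree has the same value c in both.  Regular
-- K₃-saturated graphs are obtained as circulant graphs on ℤ/m whose connection set S is
-- symmetric and sum-free with S + S covering everything non-zero outside S; then c = m - ∣ S ∣.
-- For 6a - 2 ≤ m ≤ 8a - 3 the set S = ±[a, 2a - 1] qualifies, with c = m - 2a, and joining its
-- graph to the complete bipartite graph with parts of size c gives the order 3c + 2a.  This
-- covers all orders from 59 on except nineteen, which are treated by explicit connection sets.
module Submission where

open import Defs
open import Data.Nat using (ℕ; _≥_)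
open import Data.Product using (Σ; _×_)

open import Data.Bool using (Bool; true; false; not; _∧_; _∨_; _xor_)
import Data.Bool as Bool
open import Data.Bool.ListAction using (any)
open import Data.Bool.Properties using (∨-comm; ∧-comm; not-involutive; not-distribˡ-xor)
open import Data.Empty using (⊥; ⊥-elim)
open import Data.Fin as Fin using (Fin; zero; suc; toℕ; fromℕ<; splitAt; _↑ˡ_; _↑ʳ_)
open import Data.Fin.Patterns using (0F; 1F; 2F; 3F; 4F)
open import Data.Fin.Properties
  using (toℕ<n; toℕ-fromℕ<; toℕ-injective; toℕ-↑ˡ; toℕ-↑ʳ;
         splitAt-↑ˡ; splitAt-↑ʳ; splitAt-join; join-splitAt)
open import Data.List as List using (List; length; filter; _∷_; [])
import Data.List.Membership.DecPropositional as DecMembership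
import Data.List.Relation.Unary.All as ListAll
open import Data.Nat
  using (zero; suc; _+_; _*_; _∸_; _≤_; _<_; _≡ᵇ_; ∣_-_∣; z≤n; s≤s; z<s)
open import Data.Nat.Properties as ℕ
  using (m≤m+n; m≤n+m; m≤n⇒∃[o]m+o≡n; allUpTo?; anyUpTo?)
open import Data.Nat.DivMod using (_/_; m≡m%n+[m/n]*n; m%n<n)
open import Data.Nat.Tactic.RingSolver using (solve)
open import Data.Product using (∃; ∃₂; _,_)
open import Data.Sum using (_⊎_; inj₁; inj₂; [_,_]′)
open import Data.Vec as Vec using (Vec; lookup)
open import Data.Vec.Properties using (lookup∘tabulate)
open import Data.Vec.Relation.Unary.All.Properties using (lookup⁺)
open import Data.Vec.Relation.Unary.AllPairs using (AllPairs)
open import Function using (_∘_; id; mk⇔)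
open import Relation.Binary.Definitions using (Symmetric; tri<; tri≈; tri>)
open import Relation.Binary.PropositionalEquality
  using (_≡_; _≢_; refl; trans; cong; cong₂; subst; module ≡-Reasoning)
  renaming (sym to ≡-sym)
open import Relation.Nullary using (¬_; Dec; yes; no; does; contradiction)
open import Relation.Nullary.Decidable
  using (True; toWitness; _×-dec_; _⊎-dec_; _→-dec_; dec-true; dec-false; does-⇔)

open import Algebra.Properties.CommutativeSemigroup ℕ.+-commutativeSemigroup
  using (xy∙z≈xz∙y)

private
  variable
    m n c : ℕ

-- Counting

bit : Bool → ℕ
bit true  = 1
bit false = 0

-- Recursion on `n` makes counting split along `Fin (m + n)`; `degree`, the length of a filtered
-- list, is translated once and for all by `degree≡count`.
count : ∀ {n} → (Fin n → Bool) → ℕ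
count {zero}  p = 0
count {suc n} p = bit (p zero) + count (p ∘ suc)

count-cong : ∀ {n} {p q : Fin n → Bool} → (∀ i → p i ≡ q i) → count p ≡ count q
count-cong {zero}  p≗q = refl
count-cong {suc n} p≗q = cong₂ _+_ (cong bit (p≗q zero)) (count-cong (p≗q ∘ suc))

count-const : ∀ v n → count {n} (λ _ → v) ≡ bit v * n
count-const true  zero    = refl
count-const true  (suc n) = cong suc (count-const true n)
count-const false zero    = refl
count-const false (suc n) = count-const false n

count-true : ∀ n → count {n} (λ _ → true) ≡ n
count-true n = trans (count-const true n) (ℕ.*-identityˡ n)

count-++ : ∀ m {n} (p : Fin (m + n) → Bool) →
           count p ≡ count (p ∘ (_↑ˡ n)) + count (p ∘ (m ↑ʳ_))
count-++ zero    p = refl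
count-++ (suc m) p = trans (cong (bit (p zero) +_) (count-++ m (p ∘ suc)))
                           (≡-sym (ℕ.+-assoc (bit (p zero)) _ _))

-- Splits off a run on which `f` is constant. The offset moves from `lo` to `lo + k`, so
-- applications chain along consecutive intervals.
count-block : ∀ (f : ℕ → Bool) v lo k {l} → (∀ {x} → lo ≤ x → x < lo + k → f x ≡ v) →
  count {k + l} (λ i → f (lo + toℕ i)) ≡ bit v * k + count {l} (λ i → f (lo + k + toℕ i))
count-block f v lo k {l} constant = trans (count-++ k (λ i → f (lo + toℕ i))) (cong₂ _+_
  (trans (count-cong {k} λ i → trans (cong (λ x → f (lo + x)) (toℕ-↑ˡ i l))
                                 (constant (m≤m+n lo (toℕ i)) (ℕ.+-monoʳ-< lo (toℕ<n i))))
         (count-const v k))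
  (count-cong {l} λ i →
    cong f (trans (cong (lo +_) (toℕ-↑ʳ k i)) (≡-sym (ℕ.+-assoc lo k (toℕ i))))))

count-∷ʳ : ∀ k (f : ℕ → Bool) → count {suc k} (f ∘ toℕ) ≡ count {k} (f ∘ toℕ) + bit (f k)
count-∷ʳ zero    f = ℕ.+-comm (bit (f 0)) 0
count-∷ʳ (suc k) f = trans (cong (bit (f 0) +_) (count-∷ʳ k (f ∘ suc)))
                           (≡-sym (ℕ.+-assoc (bit (f 0)) _ _))

length-filter-tabulate : ∀ {A : Set} (p : A → Bool) {n} (f : Fin n → A) →
  length (filter (λ x → p x Bool.≟ true) (List.tabulate f)) ≡ count (p ∘ f)
length-filter-tabulate p {zero}  f = refl
length-filter-tabulate p {suc n} f with p (f zero)
... | true  = cong suc (length-filter-tabulate p (f ∘ suc))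
... | false = length-filter-tabulate p (f ∘ suc)

degree≡count : (G : Graph n) (v : Fin n) → degree G v ≡ count (adj G v)
degree≡count G v = length-filter-tabulate (adj G v) id

-- Symmetric complete sum-free sets

-- Residues modulo m are represented by 0, …, m - 1 and the symmetric set S ⊆ ℤ/m by its
-- characteristic function h, so that h ∣ x - y ∣ says that x - y lies in S.
record CompleteSumFree (m c : ℕ) (h : ℕ → Bool) : Set where
  field
    2≤m       : 2 ≤ m
    h0≡false  : h 0 ≡ false
    symmetric : ∀ {x y} → x + y ≡ m → h x ≡ h y
    sumFree   : ∀ {x y} → x + y < m → h x ≡ true → h y ≡ true → h (x + y) ≡ false
    complete  : ∀ {d} → 0 < d → d < m → h d ≡ false →
                ∃ λ x → x < m × h x ≡ true × h ∣ d - x ∣ ≡ true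
    size      : count {m} (h ∘ toℕ) + c ≡ m

odd : ℕ → Bool
odd zero    = false
odd (suc x) = not (odd x)

odd-+ : ∀ x y → odd (x + y) ≡ odd x xor odd y
odd-+ zero    y = refl
odd-+ (suc x) y = trans (cong not (odd-+ x y)) (not-distribˡ-xor (odd x) (odd y))

odd-2* : ∀ k → odd (2 * k) ≡ false
odd-2* zero    = refl
odd-2* (suc k) rewrite ℕ.+-suc k (k + 0) = trans (not-involutive _) (odd-2* k)

-- The circulant graph of this set is the complete bipartite graph with parts of size c.
oddResidues : ∀ c → 0 < c → CompleteSumFree (2 * c) c odd
oddResidues (suc k) _ = record
  { 2≤m       = ℕ.*-monoʳ-≤ 2 (s≤s z≤n)
  ; h0≡false  = refl
  ; symmetric = λ {x} {y} x+y≡2c → xor-injective (odd x) (odd y)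
                  (trans (≡-sym (odd-+ x y)) (trans (cong odd x+y≡2c) (odd-2* (suc k))))
  ; sumFree   = λ {x} {y} _ hx hy → trans (odd-+ x y) (cong₂ _xor_ hx hy)
  ; complete  = λ { {suc d} _ _ even →
                  -- A nonzero even residue `suc d` is 1 plus the odd number `d`.
                  1 , ℕ.*-monoʳ-≤ 2 (s≤s z≤n) , refl ,
                  trans (cong odd (ℕ.∣-∣-identityʳ d))
                        (trans (≡-sym (not-involutive (odd d))) (cong not even)) }
  ; size      = trans (cong (_+ suc k) (count-odd (suc k)))
                      (cong (suc k +_) (≡-sym (ℕ.+-identityʳ (suc k))))
  }
  where
  xor-injective : ∀ a b → a xor b ≡ false → a ≡ b
  xor-injective true  true  _ = refl
  xor-injective false false _ = refl

  count-odd : ∀ k → count {2 * k} (odd ∘ toℕ) ≡ k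
  count-odd zero    = refl
  count-odd (suc k) rewrite ℕ.+-suc k (k + 0) =
    cong suc (trans (count-cong {k + (k + 0)} (not-involutive ∘ odd ∘ toℕ)) (count-odd k))

∣m+n-m∣≡n : ∀ m n → ∣ m + n - m ∣ ≡ n
∣m+n-m∣≡n m n = trans (ℕ.∣-∣-comm (m + n) m) (ℕ.∣m-m+n∣≡n m n)

-- Linear arithmetic by certificates: L ≤ R is a combination of hypotheses, and the equation is
-- left to the ring solver.
linear : ∀ {L R X Y} slack → L ≤ R → X + R + slack ≡ Y + L → X ≤ Y
linear {L} {R} {X} {Y} slack L≤R eq = ℕ.+-cancelʳ-≤ R X Y
  (ℕ.≤-trans (ℕ.≤-trans (m≤m+n (X + R) slack) (ℕ.≤-reflexive eq)) (ℕ.+-monoʳ-≤ Y L≤R))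

does⇒ : ∀ {A : Set} (a? : Dec A) → does a? ≡ true → A
does⇒ (yes a) _ = a

-- The symmetric interval sets

module Intervals (b k : ℕ) (k≤2b+1 : k ≤ 2 * b + 1) where

  -- With a = 1 + b and m = 6b + 4 + k these are the intervals [a, 2a - 1] and
  -- [m - 2a + 1, m - a], each being the reflection of the other.
  Lower Upper Member : ℕ → Set
  Lower  x = b + 1 ≤ x × x ≤ 2 * b + 1
  Upper  x = 4 * b + 3 + k ≤ x × x ≤ 5 * b + 3 + k
  Member x = Lower x ⊎ Upper x

  member? : ∀ x → Dec (Member x)
  member? x = ((b + 1 ℕ.≤? x) ×-dec (x ℕ.≤? 2 * b + 1)) ⊎-dec
              ((4 * b + 3 + k ℕ.≤? x) ×-dec (x ℕ.≤? 5 * b + 3 + k))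

  h : ℕ → Bool
  h x = does (member? x)

  member-≥ : ∀ {x} → Member x → b + 1 ≤ x
  member-≥     (inj₁ (l≤x , _)) = l≤x
  member-≥ {x} (inj₂ (l≤x , _)) = linear (3 * b + 2 + k) l≤x (solve (b ∷ k ∷ x ∷ []))

  reflect : ∀ {x y} → x + y ≡ 6 * b + 4 + k → Member x → Member y
  reflect {x} {y} x+y≡m (inj₁ (l≤x , x≤u)) = inj₂
    ( linear 0 (ℕ.+-mono-≤ (ℕ.≤-reflexive (≡-sym x+y≡m)) x≤u) (solve (b ∷ k ∷ x ∷ y ∷ []))
    , linear 0 (ℕ.+-mono-≤ (ℕ.≤-reflexive x+y≡m) l≤x) (solve (b ∷ k ∷ x ∷ y ∷ [])) )
  reflect {x} {y} x+y≡m (inj₂ (l≤x , x≤u)) = inj₁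
    ( linear 0 (ℕ.+-mono-≤ (ℕ.≤-reflexive (≡-sym x+y≡m)) x≤u) (solve (b ∷ k ∷ x ∷ y ∷ []))
    , linear 0 (ℕ.+-mono-≤ (ℕ.≤-reflexive x+y≡m) l≤x) (solve (b ∷ k ∷ x ∷ y ∷ [])) )

  -- Sums of two members are at least 2b + 2, beyond `Lower`. Two lower members add up to at most 4b
  -- + 2, short of `Upper`; if one is upper, the sum is at least 5b + 4 + k, beyond `Upper`. Each
  -- contradiction is brought to the form 1 ≤ 0.
  sum∉Member : ∀ {x y} → Member x → Member y → ¬ Member (x + y)
  sum∉Member mx my (inj₁ (_ , x+y≤u)) = ℕ.1+n≰n {0}
    (linear 0 (ℕ.≤-trans (ℕ.+-mono-≤ (member-≥ mx) (member-≥ my)) x+y≤u) (solve (b ∷ [])))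
  sum∉Member (inj₁ (_ , x≤u)) (inj₁ (_ , y≤u)) (inj₂ (l≤x+y , _)) = ℕ.1+n≰n {0}
    (linear k (ℕ.≤-trans l≤x+y (ℕ.+-mono-≤ x≤u y≤u)) (solve (b ∷ k ∷ [])))
  sum∉Member (inj₂ (l≤x , _)) my (inj₂ (_ , x+y≤u)) = ℕ.1+n≰n {0}
    (linear 0 (ℕ.≤-trans (ℕ.+-mono-≤ l≤x (member-≥ my)) x+y≤u) (solve (b ∷ k ∷ [])))
  sum∉Member (inj₁ (l≤x , _)) (inj₂ (l≤y , _)) (inj₂ (_ , x+y≤u)) = ℕ.1+n≰n {0}
    (linear 0 (ℕ.≤-trans (ℕ.+-mono-≤ l≤x l≤y) x+y≤u) (solve (b ∷ k ∷ [])))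

  member<m : ∀ {x} → Member x → x < 6 * b + 4 + k
  member<m {x} (inj₁ (_ , x≤u)) = linear (4 * b + 2 + k) x≤u (solve (b ∷ k ∷ x ∷ []))
  member<m {x} (inj₂ (_ , x≤u)) = linear b x≤u (solve (b ∷ k ∷ x ∷ []))

  min∈ : Member (b + 1)
  min∈ = inj₁ (ℕ.≤-refl , linear b (z≤n {0}) (solve (b ∷ [])))

  max∈ : Member (2 * b + 1)
  max∈ = inj₁ (linear b (z≤n {0}) (solve (b ∷ [])) , ℕ.≤-refl)

  -- Since S = -S, a difference of members is also a sum of members modulo m. Allowing both forms
  -- avoids reduction modulo m.
  SumOrDifference : ℕ → Set
  SumOrDifference d = ∃₂ λ x y → Member x × Member y × (x + y ≡ d ⊎ d + y ≡ x)

  split-≤b : ∀ {d} → 1 ≤ d → d ≤ b → SumOrDifference d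
  split-≤b {d} 1≤d d≤b = d + (b + 1) , b + 1 , inj₁
    ( linear 1 1≤d (solve (b ∷ d ∷ []))
    , linear 0 d≤b (solve (b ∷ d ∷ [])) ) , min∈ , inj₂ refl

  split-≤3b+2 : ∀ {d} → 2 * b + 1 < d → d ≤ 3 * b + 2 → SumOrDifference d
  split-≤3b+2 {d} lo hi
    with y , refl ← m≤n⇒∃[o]m+o≡n {b + 1} {d} (linear (b + 1) lo (solve (b ∷ d ∷ []))) =
    b + 1 , y , min∈ , inj₁
    ( linear 0 lo (solve (b ∷ y ∷ []))
    , linear 0 hi (solve (b ∷ y ∷ [])) ) , inj₁ refl

  split-≤4b+2 : ∀ {d} → 3 * b + 2 < d → d ≤ 4 * b + 2 → SumOrDifference d
  split-≤4b+2 {d} lo hi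
    with y , refl ← m≤n⇒∃[o]m+o≡n {2 * b + 1} {d} (linear (b + 2) lo (solve (b ∷ d ∷ []))) =
    2 * b + 1 , y , max∈ , inj₁
    ( linear 1 lo (solve (b ∷ y ∷ []))
    , linear 0 hi (solve (b ∷ y ∷ [])) ) , inj₁ refl

  -- This is where `k≤2b+1` enters: `Lower` shifted up by 2b + 1 ends at 4b + 2, and `Upper` shifted
  -- down by 2b + 1 starts at 2b + 2 + k, so the bound says that no residue is missed between them.
  split-≤3b+1+k : ∀ {d} → 4 * b + 2 < d → d ≤ 3 * b + 1 + k → SumOrDifference d
  split-≤3b+1+k {d} lo hi = d + (2 * b + 1) , 2 * b + 1 , inj₂
    ( linear 0 (ℕ.+-mono-≤ lo k≤2b+1) (solve (b ∷ k ∷ d ∷ []))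
    , linear 1 hi (solve (b ∷ k ∷ d ∷ [])) ) , max∈ , inj₂ refl

  split-≤4b+2+k : ∀ {d} → 3 * b + 1 + k < d → d ≤ 4 * b + 2 + k → SumOrDifference d
  split-≤4b+2+k {d} lo hi = d + (b + 1) , b + 1 , inj₂
    ( linear 0 lo (solve (b ∷ k ∷ d ∷ []))
    , linear 0 hi (solve (b ∷ k ∷ d ∷ [])) ) , min∈ , inj₂ refl

  split-<m : ∀ {d} → 5 * b + 3 + k < d → d < 6 * b + 4 + k → SumOrDifference d
  split-<m {d} lo hi
    with y , refl ← m≤n⇒∃[o]m+o≡n {b + 1} {d}
                      (linear (4 * b + 3 + k) lo (solve (b ∷ k ∷ d ∷ []))) =
    b + 1 , y , min∈ , inj₂
    ( linear 0 lo (solve (b ∷ k ∷ y ∷ []))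
    , linear 1 hi (solve (b ∷ k ∷ y ∷ [])) ) , inj₁ refl

  -- Translates of the intervals cover the three gaps. The first is covered by `Lower` shifted down
  -- by b + 1; the middle one by `Lower` shifted up by b + 1 and 2b + 1 and by `Upper` shifted down
  -- by 2b + 1 and b + 1; the last by `Upper` shifted up by b + 1.
  sumOrDifference : ∀ {d} → 1 ≤ d → d < 6 * b + 4 + k → ¬ Member d → SumOrDifference d
  sumOrDifference {d} 1≤d d<m d∉S with ℕ.≤-<-connex d b
  ... | inj₁ d≤b = split-≤b 1≤d d≤b
  ... | inj₂ b<d with ℕ.≤-<-connex d (2 * b + 1)
  ... | inj₁ d≤2b+1 = ⊥-elim (d∉S (inj₁ (linear 0 b<d (solve (b ∷ d ∷ [])) , d≤2b+1)))
  ... | inj₂ 2b+1<d with ℕ.≤-<-connex d (3 * b + 2)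
  ... | inj₁ d≤3b+2 = split-≤3b+2 2b+1<d d≤3b+2
  ... | inj₂ 3b+2<d with ℕ.≤-<-connex d (4 * b + 2)
  ... | inj₁ d≤4b+2 = split-≤4b+2 3b+2<d d≤4b+2
  ... | inj₂ 4b+2<d with ℕ.≤-<-connex d (3 * b + 1 + k)
  ... | inj₁ d≤3b+1+k = split-≤3b+1+k 4b+2<d d≤3b+1+k
  ... | inj₂ 3b+1+k<d with ℕ.≤-<-connex d (4 * b + 2 + k)
  ... | inj₁ d≤4b+2+k = split-≤4b+2+k 3b+1+k<d d≤4b+2+k
  ... | inj₂ 4b+2+k<d with ℕ.≤-<-connex d (5 * b + 3 + k)
  ... | inj₁ d≤5b+3+k =
    ⊥-elim (d∉S (inj₂ (linear 0 4b+2+k<d (solve (b ∷ k ∷ d ∷ [])) , d≤5b+3+k)))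
  ... | inj₂ 5b+3+k<d = split-<m 5b+3+k<d d<m

  count-h : count {6 * b + 4 + k} (h ∘ toℕ) ≡ (b + 1) + (b + 1)
  count-h = begin
    count {6 * b + 4 + k} (h ∘ toℕ)
      ≡⟨ cong (λ l → count {l} (h ∘ toℕ)) length≡ ⟩
    -- Five runs: gap, `Lower`, gap, `Upper`, gap. The final `b + 0` leaves an empty remainder for
    -- the last use of `count-block`.
    count {lo₁ + (lo₁ + ((2 * b + 1 + k) + (lo₁ + (b + 0))))} (h ∘ toℕ)
      ≡⟨ count-block h false 0 lo₁ (λ _ → below) ⟩
    0 + count {lo₁ + ((2 * b + 1 + k) + (lo₁ + (b + 0)))} (λ i → h (lo₁ + toℕ i))
      ≡⟨ count-block h true lo₁ lo₁ lower ⟩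
    1 * lo₁ + count {(2 * b + 1 + k) + (lo₁ + (b + 0))} (λ i → h (lo₂ + toℕ i))
      ≡⟨ cong (1 * lo₁ +_) (count-block h false lo₂ (2 * b + 1 + k) middle) ⟩
    1 * lo₁ + count {lo₁ + (b + 0)} (λ i → h (lo₃ + toℕ i))
      ≡⟨ cong (1 * lo₁ +_) (count-block h true lo₃ lo₁ upper) ⟩
    1 * lo₁ + (1 * lo₁ + count {b + 0} (λ i → h (lo₃ + lo₁ + toℕ i)))
      ≡⟨ cong (λ e → 1 * lo₁ + (1 * lo₁ + e)) (count-block h false (lo₃ + lo₁) b {0} above) ⟩
    1 * lo₁ + (1 * lo₁ + 0)
      ≡⟨ total ⟩
    (b + 1) + (b + 1) ∎
    where
    open ≡-Reasoning
    lo₁ lo₂ lo₃ : ℕ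
    lo₁ = b + 1
    lo₂ = lo₁ + lo₁
    lo₃ = lo₂ + (2 * b + 1 + k)

    length≡ : 6 * b + 4 + k ≡ (b + 1) + ((b + 1) + ((2 * b + 1 + k) + ((b + 1) + (b + 0))))
    length≡ = solve (b ∷ k ∷ [])

    total : 1 * (b + 1) + (1 * (b + 1) + 0) ≡ (b + 1) + (b + 1)
    total = solve (b ∷ [])

    below : ∀ {x} → x < b + 1 → h x ≡ false
    below {x} x<lo = dec-false (member? x) λ x∈S → ℕ.<⇒≱ x<lo (member-≥ x∈S)

    lower : ∀ {x} → b + 1 ≤ x → x < b + 1 + (b + 1) → h x ≡ true
    lower {x} l≤x x<u = dec-true (member? x) (inj₁ (l≤x , linear 0 x<u (solve (b ∷ x ∷ []))))

    middle : ∀ {x} → b + 1 + (b + 1) ≤ x → x < b + 1 + (b + 1) + (2 * b + 1 + k) → h x ≡ false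
    middle {x} l≤x x<u = dec-false (member? x) λ
      { (inj₁ (_ , x≤2b+1)) → ℕ.1+n≰n {0} (linear 0 (ℕ.≤-trans l≤x x≤2b+1) (solve (b ∷ [])))
      ; (inj₂ (4b+3+k≤x , _)) →
          ℕ.1+n≰n {0} (linear 0 (ℕ.≤-trans (s≤s 4b+3+k≤x) x<u) (solve (b ∷ k ∷ []))) }

    upper : ∀ {x} → b + 1 + (b + 1) + (2 * b + 1 + k) ≤ x →
            x < b + 1 + (b + 1) + (2 * b + 1 + k) + (b + 1) → h x ≡ true
    upper {x} l≤x x<u = dec-true (member? x) (inj₂
      (linear 0 l≤x (solve (b ∷ k ∷ x ∷ [])) , linear 0 x<u (solve (b ∷ k ∷ x ∷ []))))

    above : ∀ {x} → b + 1 + (b + 1) + (2 * b + 1 + k) + (b + 1) ≤ x →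
            x < b + 1 + (b + 1) + (2 * b + 1 + k) + (b + 1) + b → h x ≡ false
    above {x} l≤x _ = dec-false (member? x) λ
      { (inj₁ (_ , x≤2b+1)) →
          ℕ.1+n≰n {0} (linear (3 * b + 2 + k) (ℕ.≤-trans l≤x x≤2b+1) (solve (b ∷ k ∷ [])))
      ; (inj₂ (_ , x≤5b+3+k)) →
          ℕ.1+n≰n {0} (linear 0 (ℕ.≤-trans l≤x x≤5b+3+k) (solve (b ∷ k ∷ []))) }

  completeSumFree : CompleteSumFree (6 * b + 4 + k) (4 * b + 2 + k) h
  completeSumFree = record
    { 2≤m       = linear (6 * b + 2 + k) (z≤n {0}) (solve (b ∷ k ∷ []))
    ; h0≡false  = dec-false (member? 0) λ 0∈S →
        ℕ.1+n≰n {0} (linear b (member-≥ 0∈S) (solve (b ∷ [])))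
    ; symmetric = λ {x} {y} x+y≡m → does-⇔
        (mk⇔ (reflect x+y≡m) (reflect (trans (ℕ.+-comm y x) x+y≡m))) (member? x) (member? y)
    ; sumFree   = λ {x} {y} _ hx hy → dec-false (member? (x + y))
        (sum∉Member (does⇒ (member? x) hx) (does⇒ (member? y) hy))
    ; complete  = complete
    ; size      = trans (cong (_+ (4 * b + 2 + k)) count-h) (solve (b ∷ k ∷ []))
    }
    where
    complete : ∀ {d} → 0 < d → d < 6 * b + 4 + k → h d ≡ false →
               ∃ λ x → x < 6 * b + 4 + k × h x ≡ true × h ∣ d - x ∣ ≡ true
    complete {d} 0<d d<m hd
      with sumOrDifference 0<d d<m (λ d∈S →
             contradiction (trans (≡-sym hd) (dec-true (member? d) d∈S)) λ ())
    ... | x , y , x∈S , y∈S , inj₁ refl =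
      x , member<m x∈S , dec-true (member? x) x∈S ,
      trans (cong h (∣m+n-m∣≡n x y)) (dec-true (member? y) y∈S)
    ... | x , y , x∈S , y∈S , inj₂ refl =
      x , member<m x∈S , dec-true (member? x) x∈S ,
      trans (cong h (ℕ.∣m-m+n∣≡n d y)) (dec-true (member? y) y∈S)

-- Explicit sets

-- The set of all ± s for s ∈ S.
generated : ℕ → List ℕ → ℕ → Bool
generated m S x = any (λ s → (x ≡ᵇ s) ∨ (x + s ≡ᵇ m)) S

module _ (m c : ℕ) (h : ℕ → Bool) where

  -- Every quantifier is bounded and ordered as `allUpTo?` and `anyUpTo?` expect, so that evaluation
  -- decides the whole. Symmetry runs up to x = m because h 0 and h m are compared too. Sum-freeness
  -- is asked without x + y < m, which is harmless for `generated` sets with all s strictly between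
  -- 0 and m: they are false from m on.
  Check : Set
  Check =
    (2 ≤ m) × (h 0 ≡ false) ×
    (∀ {x} → x < suc m → h x ≡ h (m ∸ x)) ×
    (∀ {x} → x < m → h x ≡ true → ∀ {y} → y < m → h y ≡ true → h (x + y) ≡ false) ×
    (∀ {d} → d < m → 0 < d → h d ≡ false → ∃ λ x → x < m × h x ≡ true × h ∣ d - x ∣ ≡ true) ×
    (count {m} (h ∘ toℕ) + c ≡ m)

  check? : Dec Check
  check? =
    (2 ℕ.≤? m) ×-dec (h 0 Bool.≟ false) ×-dec
    allUpTo? (λ x → h x Bool.≟ h (m ∸ x)) (suc m) ×-dec
    allUpTo? (λ x → (h x Bool.≟ true) →-dec
      allUpTo? (λ y → (h y Bool.≟ true) →-dec (h (x + y) Bool.≟ false)) m) m ×-dec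
    allUpTo? (λ d → (0 ℕ.<? d) →-dec (h d Bool.≟ false) →-dec
      anyUpTo? (λ x → (h x Bool.≟ true) ×-dec (h ∣ d - x ∣ Bool.≟ true)) m) m ×-dec
    (count {m} (h ∘ toℕ) + c ℕ.≟ m)

  check⇒completeSumFree : Check → CompleteSumFree m c h
  check⇒completeSumFree (2≤m , h0 , symmetric , sumFree , complete , size) = record
    { 2≤m       = 2≤m
    ; h0≡false  = h0
    ; symmetric = λ {x} {y} x+y≡m → trans
        (symmetric (s≤s (subst (x ≤_) x+y≡m (m≤m+n x y))))
        (cong h (trans (cong (_∸ x) (≡-sym x+y≡m)) (ℕ.m+n∸m≡n x y)))
    ; sumFree   = λ {x} {y} x+y<m hx hy →
        sumFree (ℕ.≤-<-trans (m≤m+n x y) x+y<m) hx (ℕ.≤-<-trans (m≤n+m y x) x+y<m) hy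
    ; complete  = λ 0<d d<m → complete d<m 0<d
    ; size      = size
    }

-- Orders obtained from intervals

-- The order 14b + 8 + 3k is m + 2c, where m = 6b + 4 + k and c = 4b + 2 + k.
InFamily : ℕ → Set
InFamily n = ∃ λ b → ∃ λ k → k ≤ 2 * b + 1 × 14 * b + 8 + 3 * k ≡ n

0<4b+2+k : ∀ b k → 0 < 4 * b + 2 + k
0<4b+2+k b k = linear (4 * b + 1 + k) (z≤n {0}) (solve (b ∷ k ∷ []))

m+2c≡order : ∀ b k → 6 * b + 4 + k + 2 * (4 * b + 2 + k) ≡ 14 * b + 8 + 3 * k
m+2c≡order b k = solve (b ∷ k ∷ [])

inFamily-+14 : InFamily n → InFamily (14 + n)
inFamily-+14 (b , k , k≤2b+1 , refl) =
  suc b , k , linear 2 k≤2b+1 (solve (b ∷ k ∷ [])) , solve (b ∷ k ∷ [])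

-- The search is applied to orders from 59 to 144 only, and b ≥ 10 already gives at least 148.
BoundedInFamily : ℕ → Set
BoundedInFamily n = ∃ λ b → b < 10 × ∃ λ k → k < 2 * b + 2 × 14 * b + 8 + 3 * k ≡ n

boundedInFamily? : ∀ n → Dec (BoundedInFamily n)
boundedInFamily? n =
  anyUpTo? (λ b → anyUpTo? (λ k → 14 * b + 8 + 3 * k ℕ.≟ n) (2 * b + 2)) 10

boundedInFamily⇒inFamily : BoundedInFamily n → InFamily n
boundedInFamily⇒inFamily (b , _ , k , k<2b+2 , eq) =
  b , k , linear 0 k<2b+2 (solve (b ∷ k ∷ [])) , eq

-- Raising b by one adds 14 to the order and only loosens the bound on k, so fourteen consecutive
-- orders, checked by evaluation, generate all later ones.
inFamily-≥131 : ∀ j → InFamily (131 + j)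
inFamily-≥131 j = subst (λ j → InFamily (131 + j)) (≡-sym (m≡m%n+[m/n]*n j 14))
                        (inPeriod (j / 14) (m%n<n j 14))
  where
  firstPeriod : ∀ {i} → i < 14 → BoundedInFamily (131 + i)
  firstPeriod = toWitness {a? = allUpTo? (λ i → boundedInFamily? (131 + i)) 14} _

  inPeriod : ∀ q {i} → i < 14 → InFamily (131 + (i + q * 14))
  inPeriod zero    {i} i<14 = subst (λ j → InFamily (131 + j)) (≡-sym (ℕ.+-identityʳ i))
                                    (boundedInFamily⇒inFamily (firstPeriod i<14))
  inPeriod (suc q) {i} i<14 = subst InFamily (shift i q) (inFamily-+14 (inPeriod q i<14))
    where
    shift : ∀ i q → 14 + (131 + (i + q * 14)) ≡ 131 + (i + (14 + q * 14))
    shift i q = solve (i ∷ q ∷ [])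

-- Circulant graphs

-- Here c counts the non-neighbours of a vertex, itself included. A join preserves this number,
-- which is why it is the parameter rather than the degree. The field `edge` completes a common
-- neighbour on the other side of a join to a triangle.
record RegularK3Saturated (n c : ℕ) : Set where
  field
    graph           : Graph n
    degree+c        : ∀ v → degree graph v + c ≡ n
    triangleFree    : ∀ u v w → adj graph u v ≡ true → adj graph v w ≡ true →
                      adj graph u w ≡ true → ⊥
    commonNeighbour : ∀ u v → u ≢ v → adj graph u v ≡ false →
                      ∃ λ w → adj graph u w ≡ true × adj graph v w ≡ true
    edge            : ∃₂ λ u v → adj graph u v ≡ true

module Circulant {h : ℕ → Bool} (S : CompleteSumFree m c h) where
  open CompleteSumFree S

  graph : Graph m
  graph = record
    { adj    = λ u v → h ∣ toℕ u - toℕ v ∣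
    ; sym    = λ u v → cong h (ℕ.∣-∣-comm (toℕ u) (toℕ v))
    ; irrefl = λ v → trans (cong h (ℕ.∣n-n∣≡0 (toℕ v))) h0≡false
    }

  -- Row v + 1 of the adjacency matrix is row v with its last entry dropped and h (v + 1) put in
  -- front. With m = k + 1 the dropped entry is h (k - v), equal to the new one by symmetry. The
  -- modulus is a fresh argument so that it can be matched as `suc k`.
  rotate : ∀ m → (∀ {x y} → x + y ≡ m → h x ≡ h y) → ∀ v → v < m →
           count {m} (λ w → h ∣ v - toℕ w ∣) ≡ count {m} (h ∘ toℕ)
  rotate (suc k) symm zero    _ = refl
  rotate (suc k) symm (suc v) (s≤s v<k) with e , refl ← m≤n⇒∃[o]m+o≡n v<k = begin
    bit (h (suc v)) + count {k} (λ w → h ∣ v - toℕ w ∣)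
      ≡⟨ ℕ.+-comm (bit (h (suc v))) _ ⟩
    count {k} (λ w → h ∣ v - toℕ w ∣) + bit (h (suc v))
      ≡⟨ cong (λ b → count {k} (λ w → h ∣ v - toℕ w ∣) + bit b) hv≡hk-v ⟩
    count {k} (λ w → h ∣ v - toℕ w ∣) + bit (h ∣ v - k ∣)
      ≡⟨ count-∷ʳ k (λ w → h ∣ v - w ∣) ⟨
    count {suc k} (λ w → h ∣ v - toℕ w ∣)
      ≡⟨ rotate (suc k) symm v (s≤s (ℕ.<⇒≤ v<k)) ⟩
    count {suc k} (h ∘ toℕ) ∎
    where
    open ≡-Reasoning
    hv≡hk-v : h (suc v) ≡ h ∣ v - k ∣
    hv≡hk-v = symm (trans (cong (suc v +_)
      (trans (cong (∣ v -_∣) (≡-sym (ℕ.+-suc v e))) (ℕ.∣m-m+n∣≡n v (suc e))))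
      (ℕ.+-suc (suc v) e))

  degree+c : ∀ v → degree graph v + c ≡ m
  degree+c v = trans
    (cong (_+ c) (trans (degree≡count graph v) (rotate m symmetric (toℕ v) (toℕ<n v)))) size

  -- For sorted vertices the two consecutive differences add up to the third, which is below m;
  -- hence `sumFree` only has to speak of sums without wrap-around.
  triangleFree-ordered : ∀ {x y z} → x ≤ y → y ≤ z → z < m →
    h ∣ x - y ∣ ≡ true → h ∣ y - z ∣ ≡ true → h ∣ x - z ∣ ≡ true → ⊥
  triangleFree-ordered {x} x≤y y≤z z<m hp hq hpq
    with p , refl ← m≤n⇒∃[o]m+o≡n x≤y
    with q , refl ← m≤n⇒∃[o]m+o≡n y≤z
    rewrite ℕ.∣m-m+n∣≡n (x + p) q | ℕ.+-assoc x p q | ℕ.∣m-m+n∣≡n x p | ℕ.∣m-m+n∣≡n x (p + q)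
    with () ← trans (≡-sym hpq) (sumFree (ℕ.≤-<-trans (m≤n+m (p + q) x) z<m) hp hq)

  flip : ∀ x y → h ∣ x - y ∣ ≡ true → h ∣ y - x ∣ ≡ true
  flip x y = trans (cong h (ℕ.∣-∣-comm y x))

  triangleFree : ∀ {x y z} → x < m → y < m → z < m →
    h ∣ x - y ∣ ≡ true → h ∣ y - z ∣ ≡ true → h ∣ x - z ∣ ≡ true → ⊥
  triangleFree {x} {y} {z} x<m y<m z<m xy yz xz
    with ℕ.≤-total x y | ℕ.≤-total y z | ℕ.≤-total x z
  ... | inj₁ x≤y | inj₁ y≤z | _        = triangleFree-ordered x≤y y≤z z<m xy yz xz
  ... | inj₁ _   | inj₂ z≤y | inj₁ x≤z = triangleFree-ordered x≤z z≤y y<m xz (flip y z yz) xy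
  ... | inj₁ x≤y | inj₂ _   | inj₂ z≤x =
    triangleFree-ordered z≤x x≤y y<m (flip x z xz) xy (flip y z yz)
  ... | inj₂ y≤x | inj₁ _   | inj₁ x≤z = triangleFree-ordered y≤x x≤z z<m (flip x y xy) xz yz
  ... | inj₂ _   | inj₁ y≤z | inj₂ z≤x =
    triangleFree-ordered y≤z z≤x x<m yz (flip x z xz) (flip x y xy)
  ... | inj₂ y≤x | inj₂ z≤y | _        =
    triangleFree-ordered z≤y y≤x x<m (flip y z yz) (flip x y xy) (flip x z xz)

  CommonNeighbour : ℕ → ℕ → Set
  CommonNeighbour x y = ∃ λ z → z < m × h ∣ x - z ∣ ≡ true × h ∣ y - z ∣ ≡ true

  -- For d = v - u ∉ S and x, d - x ∈ S, the common neighbour is u + x modulo m.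
  commonNeighbour-ordered : ∀ {u v} → u < v → v < m → h ∣ u - v ∣ ≡ false → CommonNeighbour u v
  commonNeighbour-ordered {u} {v} u<v v<m hd
    with e , refl ← m≤n⇒∃[o]m+o≡n u<v
    with x , x<m , hx , hd-x ← complete {suc e} z<s
           (ℕ.≤-<-trans (m≤n+m (suc e) u) (subst (_< m) (≡-sym (ℕ.+-suc u e)) v<m))
           (trans (cong h (≡-sym (trans (cong ∣ u -_∣ (≡-sym (ℕ.+-suc u e)))
                                        (ℕ.∣m-m+n∣≡n u (suc e))))) hd)
    rewrite ≡-sym (ℕ.+-suc u e)
    with d ← suc e
    with ℕ.<-≤-connex (u + x) m
  ... | inj₁ u+x<m =
    u + x , u+x<m , trans (cong h (ℕ.∣m-m+n∣≡n u x)) hx ,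
    trans (cong h (ℕ.∣m+n-m+o∣≡∣n-o∣ u d x)) hd-x
  -- Wrap-around: the neighbour is w = u + x - m. Writing u = w + p and x = d + q gives p + d + q =
  -- m, so symmetry turns the distances p and p + d from w into x and q = x - d.
  ... | inj₂ m≤u+x
    with w , eq ← m≤n⇒∃[o]m+o≡n m≤u+x
    with w<u ← ℕ.+-cancelʳ-< x w u
                 (subst (w + x <_) (trans (ℕ.+-comm w m) eq) (ℕ.+-monoʳ-< w x<m))
    with q , refl ← m≤n⇒∃[o]m+o≡n (ℕ.<⇒≤ (ℕ.+-cancelˡ-< u d x (ℕ.<-≤-trans v<m m≤u+x)))
    with p , refl ← m≤n⇒∃[o]m+o≡n (ℕ.<⇒≤ w<u) =
    w , ℕ.<-trans w<u (ℕ.≤-<-trans (m≤m+n (w + p) d) v<m) ,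
    trans (cong h (∣m+n-m∣≡n w p)) (trans (symmetric p+x≡m) hx) ,
    trans (cong h (trans (cong ∣_- w ∣ (ℕ.+-assoc w p d)) (∣m+n-m∣≡n w (p + d))))
      (trans (symmetric (trans (ℕ.+-assoc p d q) p+x≡m))
        (trans (≡-sym (cong h (ℕ.∣m-m+n∣≡n d q))) hd-x))
    where
    p+x≡m : p + (d + q) ≡ m
    p+x≡m = ℕ.+-cancelˡ-≡ w _ _
      (trans (≡-sym (ℕ.+-assoc w p (d + q))) (trans (≡-sym eq) (ℕ.+-comm m w)))

  commonNeighbour : ∀ {u v} → u ≢ v → u < m → v < m → h ∣ u - v ∣ ≡ false → CommonNeighbour u v
  commonNeighbour {u} {v} u≢v u<m v<m hd with ℕ.<-cmp u v
  ... | tri< u<v _ _ = commonNeighbour-ordered u<v v<m hd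
  ... | tri≈ _ u≡v _ = contradiction u≡v u≢v
  ... | tri> _ _ v<u
    with w , w<m , vw , uw ←
         commonNeighbour-ordered v<u u<m (trans (cong h (ℕ.∣-∣-comm v u)) hd) =
    w , w<m , uw , vw

  -- Either 1 lies in S, or completeness at d = 1 yields a member.
  nonempty : ∃ λ x → x < m × h x ≡ true
  nonempty with h 1 in h1
  ... | true  = 1 , 2≤m , h1
  ... | false with x , x<m , hx , _ ← complete z<s 2≤m h1 = x , x<m , hx

  regularK3Saturated : RegularK3Saturated m c
  regularK3Saturated = record
    { graph           = graph
    ; degree+c        = degree+c
    ; triangleFree    = λ u v w → triangleFree (toℕ<n u) (toℕ<n v) (toℕ<n w)
    ; commonNeighbour = λ u v u≢v u≁v →
        let w , w<m , uw , vw = commonNeighbour (u≢v ∘ toℕ-injective) (toℕ<n u) (toℕ<n v) u≁v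
        in fromℕ< w<m , trans (cong (λ k → h ∣ toℕ u - k ∣) (toℕ-fromℕ< w<m)) uw
                      , trans (cong (λ k → h ∣ toℕ v - k ∣) (toℕ-fromℕ< w<m)) vw
    ; edge            =
        let x , x<m , hx = nonempty
            0<m          = ℕ.<-trans z<s 2≤m
        in fromℕ< 0<m , fromℕ< x<m ,
           trans (cong₂ (λ k l → h ∣ k - l ∣) (toℕ-fromℕ< 0<m) (toℕ-fromℕ< x<m)) hx
    }

-- Cliques

open import Data.Vec using ([]; _∷_)
open import Data.Vec.Relation.Unary.All using ([]; _∷_)
open import Data.Vec.Relation.Unary.AllPairs using ([]; _∷_)

AllPairs-lookup : ∀ {A : Set} {R : A → A → Set} → Symmetric R → {xs : Vec A n} →
                  AllPairs R xs → ∀ i j → i ≢ j → R (lookup xs i) (lookup xs j)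
AllPairs-lookup s (r ∷ rs) zero    zero    i≢j = contradiction refl i≢j
AllPairs-lookup s (r ∷ rs) zero    (suc j) i≢j = lookup⁺ r j
AllPairs-lookup s (r ∷ rs) (suc i) zero    i≢j = s (lookup⁺ r i)
AllPairs-lookup s (r ∷ rs) (suc i) (suc j) i≢j = AllPairs-lookup s rs i j (i≢j ∘ cong suc)

-- Injectivity comes for free: distinct positions hold adjacent vertices, and no vertex is adjacent
-- to itself.
clique⇒HasK5 : (a : Fin n → Fin n → Bool) →
               (∀ x y → a x y ≡ a y x) → (∀ x → a x x ≡ false) →
               (xs : Vec (Fin n) 5) → AllPairs (λ x y → a x y ≡ true) xs → HasK5 a
clique⇒HasK5 a a-sym a-irrefl xs clique = lookup xs , injective , adjacent
  where
  adjacent : ∀ i j → i ≢ j → a (lookup xs i) (lookup xs j) ≡ true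
  adjacent = AllPairs-lookup (λ {x} {y} axy → trans (a-sym y x) axy) clique

  injective : ∀ {i j} → lookup xs i ≡ lookup xs j → i ≡ j
  injective {i} {j} eq with i Fin.≟ j
  ... | yes i≡j = i≡j
  ... | no  i≢j = contradiction
    (trans (≡-sym (adjacent i j i≢j)) (trans (cong (λ x → a x _) eq) (a-irrefl _)))
    λ ()

module _ (G : Graph n) {u v : Fin n} where

  private
    _∼_ : Fin n → Fin n → Bool
    _∼_ = addEdge (adj G) u v

  addEdge-sym : ∀ x y → (x ∼ y) ≡ (y ∼ x)
  addEdge-sym x y = cong₂ _∨_ (Graph.sym G x y)
    (trans (∨-comm (does (x Fin.≟ u) ∧ does (y Fin.≟ v)) _)
           (cong₂ _∨_ (∧-comm (does (x Fin.≟ v)) _) (∧-comm (does (x Fin.≟ u)) _)))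

  addEdge-irrefl : u ≢ v → ∀ x → (x ∼ x) ≡ false
  addEdge-irrefl u≢v x rewrite irrefl G x with x Fin.≟ u | x Fin.≟ v
  ... | yes refl | yes refl = contradiction refl u≢v
  ... | yes _    | no  _    = refl
  ... | no  _    | yes _    = refl
  ... | no  _    | no  _    = refl

  addEdge-old : ∀ {x y} → adj G x y ≡ true → (x ∼ y) ≡ true
  addEdge-old x∼y rewrite x∼y = refl

  addEdge-new : (u ∼ v) ≡ true
  addEdge-new rewrite dec-true (u Fin.≟ u) refl | dec-true (v Fin.≟ v) refl
    with adj G u v
  ... | true  = refl
  ... | false = refl

  addEdge-HasK5 : u ≢ v → ∀ {x y z} →
    adj G u x ≡ true → adj G u y ≡ true → adj G u z ≡ true →
    adj G v x ≡ true → adj G v y ≡ true → adj G v z ≡ true →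
    adj G x y ≡ true → adj G x z ≡ true → adj G y z ≡ true → HasK5 _∼_
  addEdge-HasK5 u≢v {x} {y} {z} ux uy uz vx vy vz xy xz yz =
    clique⇒HasK5 _∼_ addEdge-sym (addEdge-irrefl u≢v) (u ∷ v ∷ x ∷ y ∷ z ∷ [])
      ( (addEdge-new ∷ addEdge-old ux ∷ addEdge-old uy ∷ addEdge-old uz ∷ [])
      ∷ (addEdge-old vx ∷ addEdge-old vy ∷ addEdge-old vz ∷ [])
      ∷ (addEdge-old xy ∷ addEdge-old xz ∷ [])
      ∷ (addEdge-old yz ∷ [])
      ∷ [] ∷ [])

-- Pigeonhole for two classes and five vertices

record ThreeAgreeing (p : Fin 5 → Bool) : Set where
  constructor agreeing
  field
    i j k : Fin 5
    i≢j   : i ≢ j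
    j≢k   : j ≢ k
    i≢k   : i ≢ k
    pi≡pj : p i ≡ p j
    pj≡pk : p j ≡ p k

-- Stated for vectors, since their entries can be matched on; `threeAgreeing` carries it over to
-- functions.
agreeing₅ : (xs : Vec Bool 5) → ThreeAgreeing (lookup xs)
agreeing₅ (true  ∷ true  ∷ true  ∷ _     ∷ _     ∷ []) = agreeing 0F 1F 2F (λ ()) (λ ()) (λ ()) refl refl
agreeing₅ (true  ∷ true  ∷ false ∷ true  ∷ _     ∷ []) = agreeing 0F 1F 3F (λ ()) (λ ()) (λ ()) refl refl
agreeing₅ (true  ∷ true  ∷ false ∷ false ∷ true  ∷ []) = agreeing 0F 1F 4F (λ ()) (λ ()) (λ ()) refl refl
agreeing₅ (true  ∷ true  ∷ false ∷ false ∷ false ∷ []) = agreeing 2F 3F 4F (λ ()) (λ ()) (λ ()) refl refl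
agreeing₅ (true  ∷ false ∷ true  ∷ true  ∷ _     ∷ []) = agreeing 0F 2F 3F (λ ()) (λ ()) (λ ()) refl refl
agreeing₅ (true  ∷ false ∷ true  ∷ false ∷ true  ∷ []) = agreeing 0F 2F 4F (λ ()) (λ ()) (λ ()) refl refl
agreeing₅ (true  ∷ false ∷ true  ∷ false ∷ false ∷ []) = agreeing 1F 3F 4F (λ ()) (λ ()) (λ ()) refl refl
agreeing₅ (true  ∷ false ∷ false ∷ true  ∷ true  ∷ []) = agreeing 0F 3F 4F (λ ()) (λ ()) (λ ()) refl refl
agreeing₅ (true  ∷ false ∷ false ∷ true  ∷ false ∷ []) = agreeing 1F 2F 4F (λ ()) (λ ()) (λ ()) refl refl
agreeing₅ (true  ∷ false ∷ false ∷ false ∷ _     ∷ []) = agreeing 1F 2F 3F (λ ()) (λ ()) (λ ()) refl refl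
agreeing₅ (false ∷ true  ∷ true  ∷ true  ∷ _     ∷ []) = agreeing 1F 2F 3F (λ ()) (λ ()) (λ ()) refl refl
agreeing₅ (false ∷ true  ∷ true  ∷ false ∷ true  ∷ []) = agreeing 1F 2F 4F (λ ()) (λ ()) (λ ()) refl refl
agreeing₅ (false ∷ true  ∷ true  ∷ false ∷ false ∷ []) = agreeing 0F 3F 4F (λ ()) (λ ()) (λ ()) refl refl
agreeing₅ (false ∷ true  ∷ false ∷ true  ∷ true  ∷ []) = agreeing 1F 3F 4F (λ ()) (λ ()) (λ ()) refl refl
agreeing₅ (false ∷ true  ∷ false ∷ true  ∷ false ∷ []) = agreeing 0F 2F 4F (λ ()) (λ ()) (λ ()) refl refl
agreeing₅ (false ∷ true  ∷ false ∷ false ∷ _     ∷ []) = agreeing 0F 2F 3F (λ ()) (λ ()) (λ ()) refl refl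
agreeing₅ (false ∷ false ∷ true  ∷ true  ∷ true  ∷ []) = agreeing 2F 3F 4F (λ ()) (λ ()) (λ ()) refl refl
agreeing₅ (false ∷ false ∷ true  ∷ true  ∷ false ∷ []) = agreeing 0F 1F 4F (λ ()) (λ ()) (λ ()) refl refl
agreeing₅ (false ∷ false ∷ true  ∷ false ∷ _     ∷ []) = agreeing 0F 1F 3F (λ ()) (λ ()) (λ ()) refl refl
agreeing₅ (false ∷ false ∷ false ∷ _     ∷ _     ∷ []) = agreeing 0F 1F 2F (λ ()) (λ ()) (λ ()) refl refl

threeAgreeing : (p : Fin 5 → Bool) → ThreeAgreeing p
threeAgreeing p = agreeing i j k i≢j j≢k i≢k (agree pi≡pj) (agree pj≡pk)
  where
  open ThreeAgreeing (agreeing₅ (Vec.tabulate p))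

  agree : ∀ {i j} → lookup (Vec.tabulate p) i ≡ lookup (Vec.tabulate p) j → p i ≡ p j
  agree {i} {j} eq = trans (≡-sym (lookup∘tabulate p i)) (trans eq (lookup∘tabulate p j))

-- Joins

RegularK5SaturatedGraph : ℕ → Set
RegularK5SaturatedGraph n = Σ (Graph n) λ G → Regular G × K5Saturated G

module Join (A : RegularK3Saturated m c) (B : RegularK3Saturated n c) where

  private
    module A = RegularK3Saturated A
    module B = RegularK3Saturated B

  -- On the disjoint sum the join computes by matching; `side` transports it to `Fin (m + n)`.
  adj⊎ : Fin m ⊎ Fin n → Fin m ⊎ Fin n → Bool
  adj⊎ (inj₁ x) (inj₁ y) = adj A.graph x y
  adj⊎ (inj₁ _) (inj₂ _) = true
  adj⊎ (inj₂ _) (inj₁ _) = true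
  adj⊎ (inj₂ x) (inj₂ y) = adj B.graph x y

  adj⊎-sym : ∀ x y → adj⊎ x y ≡ adj⊎ y x
  adj⊎-sym (inj₁ x) (inj₁ y) = Graph.sym A.graph x y
  adj⊎-sym (inj₁ _) (inj₂ _) = refl
  adj⊎-sym (inj₂ _) (inj₁ _) = refl
  adj⊎-sym (inj₂ x) (inj₂ y) = Graph.sym B.graph x y

  adj⊎-irrefl : ∀ x → adj⊎ x x ≡ false
  adj⊎-irrefl (inj₁ x) = irrefl A.graph x
  adj⊎-irrefl (inj₂ x) = irrefl B.graph x

  side : Fin (m + n) → Fin m ⊎ Fin n
  side = splitAt m

  join : Graph (m + n)
  join = record
    { adj    = λ u v → adj⊎ (side u) (side v)
    ; sym    = λ u v → adj⊎-sym (side u) (side v)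
    ; irrefl = adj⊎-irrefl ∘ side
    }

  -- A vertex is adjacent to the whole other side, so its c non-neighbours stay the same.
  degree⊎+c : ∀ s → count (adj⊎ s ∘ side) + c ≡ m + n
  degree⊎+c (inj₁ x) = begin
    count (adj⊎ (inj₁ x) ∘ side) + c        ≡⟨ cong (_+ c) (count-++ m (adj⊎ (inj₁ x) ∘ side)) ⟩
    count (adj⊎ (inj₁ x) ∘ side ∘ (_↑ˡ n)) + count (adj⊎ (inj₁ x) ∘ side ∘ (m ↑ʳ_)) + c
      ≡⟨ cong (_+ c) (cong₂ _+_
           (count-cong λ i → cong (adj⊎ (inj₁ x)) (splitAt-↑ˡ m i n))
           (trans (count-cong λ i → cong (adj⊎ (inj₁ x)) (splitAt-↑ʳ m n i)) (count-true n))) ⟩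
    count (adj A.graph x) + n + c           ≡⟨ cong (λ k → k + n + c) (degree≡count A.graph x) ⟨
    degree A.graph x + n + c                ≡⟨ xy∙z≈xz∙y (degree A.graph x) n c ⟩
    degree A.graph x + c + n                ≡⟨ cong (_+ n) (A.degree+c x) ⟩
    m + n                                   ∎
    where open ≡-Reasoning
  degree⊎+c (inj₂ x) = begin
    count (adj⊎ (inj₂ x) ∘ side) + c        ≡⟨ cong (_+ c) (count-++ m (adj⊎ (inj₂ x) ∘ side)) ⟩
    count (adj⊎ (inj₂ x) ∘ side ∘ (_↑ˡ n)) + count (adj⊎ (inj₂ x) ∘ side ∘ (m ↑ʳ_)) + c
      ≡⟨ cong (_+ c) (cong₂ _+_
           (trans (count-cong λ i → cong (adj⊎ (inj₂ x)) (splitAt-↑ˡ m i n)) (count-true m))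
           (count-cong λ i → cong (adj⊎ (inj₂ x)) (splitAt-↑ʳ m n i))) ⟩
    m + count (adj B.graph x) + c           ≡⟨ cong (λ k → m + k + c) (degree≡count B.graph x) ⟨
    m + degree B.graph x + c                ≡⟨ ℕ.+-assoc m _ c ⟩
    m + (degree B.graph x + c)              ≡⟨ cong (m +_) (B.degree+c x) ⟩
    m + n                                   ∎
    where open ≡-Reasoning

  join-regular : Regular join
  join-regular = m + n ∸ c , λ v → begin
    degree join v                           ≡⟨ degree≡count join v ⟩
    count (adj join v)                      ≡⟨ ℕ.m+n∸n≡m _ c ⟨
    count (adj join v) + c ∸ c              ≡⟨ cong (_∸ c) (degree⊎+c (side v)) ⟩
    m + n ∸ c                               ∎
    where open ≡-Reasoning

  isLeft : Fin m ⊎ Fin n → Bool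
  isLeft (inj₁ _) = true
  isLeft (inj₂ _) = false

  triangle⇒sidesDiffer : ∀ x y z → isLeft x ≡ isLeft y → isLeft y ≡ isLeft z →
    adj⊎ x y ≡ true → adj⊎ y z ≡ true → adj⊎ x z ≡ true → ⊥
  triangle⇒sidesDiffer (inj₁ x) (inj₁ y) (inj₁ z) _ _ = A.triangleFree x y z
  triangle⇒sidesDiffer (inj₂ x) (inj₂ y) (inj₂ z) _ _ = B.triangleFree x y z

  -- Three of five pairwise adjacent vertices lie on one side and would form a triangle there.
  join-K5-free : ¬ HasK5 (adj join)
  join-K5-free (f , _ , clique) =
    triangle⇒sidesDiffer (side (f i)) (side (f j)) (side (f k)) pi≡pj pj≡pk
      (clique i j i≢j) (clique j k j≢k) (clique i k i≢k)
    where open ThreeAgreeing (threeAgreeing (isLeft ∘ side ∘ f))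

  CommonTriangle : Fin m ⊎ Fin n → Fin m ⊎ Fin n → Set
  CommonTriangle s t = ∃ λ x → ∃₂ λ y z →
    (adj⊎ s x ≡ true × adj⊎ s y ≡ true × adj⊎ s z ≡ true) ×
    (adj⊎ t x ≡ true × adj⊎ t y ≡ true × adj⊎ t z ≡ true) ×
    (adj⊎ x y ≡ true × adj⊎ x z ≡ true × adj⊎ y z ≡ true)

  -- Non-adjacent vertices are on the same side. A common neighbour there and any edge of the other
  -- side form the triangle.
  commonTriangle : ∀ s t → s ≢ t → adj⊎ s t ≡ false → CommonTriangle s t
  commonTriangle (inj₁ u) (inj₁ v) s≢t u≁v
    with w , u∼w , v∼w ← A.commonNeighbour u v (s≢t ∘ cong inj₁) u≁v
       | x , y , x∼y ← B.edge =
    inj₁ w , inj₂ x , inj₂ y , (u∼w , refl , refl) , (v∼w , refl , refl) , (refl , refl , x∼y)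
  commonTriangle (inj₂ u) (inj₂ v) s≢t u≁v
    with w , u∼w , v∼w ← B.commonNeighbour u v (s≢t ∘ cong inj₂) u≁v
       | x , y , x∼y ← A.edge =
    inj₂ w , inj₁ x , inj₁ y , (u∼w , refl , refl) , (v∼w , refl , refl) , (refl , refl , x∼y)

  side-injective : ∀ {u v} → side u ≡ side v → u ≡ v
  side-injective {u} {v} eq =
    trans (≡-sym (join-splitAt m n u)) (trans (cong (Fin.join m n) eq) (join-splitAt m n v))

  adj-join : ∀ s t → adj join (Fin.join m n s) (Fin.join m n t) ≡ adj⊎ s t
  adj-join s t = cong₂ adj⊎ (splitAt-join m n s) (splitAt-join m n t)

  adj-joinʳ : ∀ u t → adj join u (Fin.join m n t) ≡ adj⊎ (side u) t
  adj-joinʳ u t = cong (adj⊎ (side u)) (splitAt-join m n t)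

  join-saturated : ∀ u v → u ≢ v → adj join u v ≡ false → HasK5 (addEdge (adj join) u v)
  join-saturated u v u≢v u≁v
    with x , y , z , (ux , uy , uz) , (vx , vy , vz) , (xy , xz , yz) ←
         commonTriangle (side u) (side v) (u≢v ∘ side-injective) u≁v =
    addEdge-HasK5 join u≢v
      (trans (adj-joinʳ u x) ux) (trans (adj-joinʳ u y) uy) (trans (adj-joinʳ u z) uz)
      (trans (adj-joinʳ v x) vx) (trans (adj-joinʳ v y) vy) (trans (adj-joinʳ v z) vz)
      (trans (adj-join x y) xy) (trans (adj-join x z) xz) (trans (adj-join y z) yz)

join : RegularK3Saturated m c → RegularK3Saturated n c → RegularK5SaturatedGraph (m + n)
join A B = Join.join A B , join-regular , join-K5-free , join-saturated
  where open Join A B using (join-regular; join-K5-free; join-saturated)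

completeBipartite : ∀ c → 0 < c → RegularK3Saturated (2 * c) c
completeBipartite c 0<c = Circulant.regularK3Saturated (oddResidues c 0<c)

inFamily⇒graph : InFamily n → RegularK5SaturatedGraph n
inFamily⇒graph (b , k , k≤2b+1 , eq) = subst RegularK5SaturatedGraph (trans (m+2c≡order b k) eq)
  (join (Circulant.regularK3Saturated (Intervals.completeSumFree b k k≤2b+1))
        (completeBipartite (4 * b + 2 + k) (0<4b+2+k b k)))

-- Exceptional orders

circulant : ∀ m c (S : List ℕ) {_ : True (check? m c (generated m S))} → RegularK3Saturated m c
circulant m c S {ok} =
  Circulant.regularK3Saturated (check⇒completeSumFree m c (generated m S) (toWitness ok))

-- For fixed b the family is a progression of difference 3, so a residue class modulo 3 is met only
-- by every third b. These are the orders from 59 on that fall between successive progressions of a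
-- class.
exceptions : List ℕ
exceptions = 60 ∷ 61 ∷ 63 ∷ 66 ∷ 69 ∷ 72 ∷ 74 ∷ 75 ∷ 77 ∷ 80 ∷ 83 ∷ 86 ∷ 89 ∷ 94 ∷ 97 ∷
             100 ∷ 103 ∷ 114 ∷ 117 ∷ []

-- The connection sets were found by computer search.
exceptionalGraphs : ListAll.All RegularK5SaturatedGraph exceptions
exceptionalGraphs =
  -- At the orders 4c in the list, two complete bipartite graphs are joined into the complete
  -- four-partite graph with parts of size c.
  join (completeBipartite 15 z<s) (completeBipartite 15 z<s) ListAll.∷
  join (circulant 29 21 (4 ∷ 5 ∷ 6 ∷ 7 ∷ []))
       (circulant 32 21 (11 ∷ 12 ∷ 13 ∷ 14 ∷ 15 ∷ 16 ∷ [])) ListAll.∷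
  join (circulant 31 23 (2 ∷ 3 ∷ 8 ∷ 9 ∷ []))
       (circulant 32 23 (7 ∷ 11 ∷ 13 ∷ 15 ∷ 16 ∷ [])) ListAll.∷
  join (circulant 28 19 (1 ∷ 3 ∷ 5 ∷ 12 ∷ 14 ∷ [])) (completeBipartite 19 z<s) ListAll.∷
  join (circulant 33 25 (4 ∷ 6 ∷ 7 ∷ 9 ∷ []))
       (circulant 36 25 (1 ∷ 4 ∷ 7 ∷ 13 ∷ 15 ∷ 18 ∷ [])) ListAll.∷
  join (completeBipartite 18 z<s) (completeBipartite 18 z<s) ListAll.∷
  join (circulant 30 22 (6 ∷ 7 ∷ 9 ∷ 11 ∷ [])) (completeBipartite 22 z<s) ListAll.∷
  join (circulant 33 21 (2 ∷ 3 ∷ 8 ∷ 9 ∷ 13 ∷ 14 ∷ [])) (completeBipartite 21 z<s) ListAll.∷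
  join (circulant 31 23 (2 ∷ 3 ∷ 8 ∷ 9 ∷ [])) (completeBipartite 23 z<s) ListAll.∷
  join (completeBipartite 20 z<s) (completeBipartite 20 z<s) ListAll.∷
  join (circulant 33 25 (4 ∷ 6 ∷ 7 ∷ 9 ∷ [])) (completeBipartite 25 z<s) ListAll.∷
  join (circulant 36 25 (1 ∷ 4 ∷ 7 ∷ 13 ∷ 15 ∷ 18 ∷ [])) (completeBipartite 25 z<s) ListAll.∷
  join (circulant 35 27 (8 ∷ 12 ∷ 14 ∷ 17 ∷ [])) (completeBipartite 27 z<s) ListAll.∷
  join (circulant 38 28 (2 ∷ 5 ∷ 11 ∷ 14 ∷ 15 ∷ [])) (completeBipartite 28 z<s) ListAll.∷
  join (circulant 39 29 (5 ∷ 7 ∷ 8 ∷ 9 ∷ 11 ∷ [])) (completeBipartite 29 z<s) ListAll.∷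
  join (completeBipartite 25 z<s) (completeBipartite 25 z<s) ListAll.∷
  join (circulant 41 31 (2 ∷ 5 ∷ 11 ∷ 12 ∷ 20 ∷ [])) (completeBipartite 31 z<s) ListAll.∷
  join (circulant 46 34 (2 ∷ 3 ∷ 7 ∷ 8 ∷ 20 ∷ 21 ∷ [])) (completeBipartite 34 z<s) ListAll.∷
  join (circulant 47 35 (2 ∷ 6 ∷ 11 ∷ 16 ∷ 19 ∷ 23 ∷ [])) (completeBipartite 35 z<s) ListAll.∷
  ListAll.[]

open DecMembership ℕ._≟_ using (_∈_; _∈?_)

inFamilyOrException : ∀ {i} → i < 72 → BoundedInFamily (59 + i) ⊎ 59 + i ∈ exceptions
inFamilyOrException = toWitness
  {a? = allUpTo? (λ i → boundedInFamily? (59 + i) ⊎-dec (59 + i ∈? exceptions)) 72} _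

theorem3p5 : (n : ℕ) → n ≥ 59 → Σ (Graph n) λ G → Regular G × K5Saturated G
theorem3p5 n n≥59 = [ small , large ]′ (ℕ.<-≤-connex n 131)
  where
  large : 131 ≤ n → RegularK5SaturatedGraph n
  large n≥131 =
    let j , eq = m≤n⇒∃[o]m+o≡n n≥131
    in subst RegularK5SaturatedGraph eq (inFamily⇒graph (inFamily-≥131 j))

  small : n < 131 → RegularK5SaturatedGraph n
  small n<131 =
    let i , eq = m≤n⇒∃[o]m+o≡n n≥59
        i<72   = ℕ.+-cancelˡ-< 59 i 72 (subst (_< 131) (≡-sym eq) n<131)
    in [ inFamily⇒graph ∘ boundedInFamily⇒inFamily , ListAll.lookup exceptionalGraphs ]′
         (subst (λ n → BoundedInFamily n ⊎ n ∈ exceptions) eq (inFamilyOrException i<72))
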